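{- Let $t,q,\kappa$ be nonzero constants. Let $P_n(z)$, $n\in\mathbb{N}$, be the Laurent biorthogonal polynomials determined by $$P_{n+1}(z) = (z - c_n) P_n(z) - b_n z P_{n-1}(z)\quad (n\ge 1),\qquad P_0(z)=1,\quad P_1(z)=z-c_0,$$ with the coefficients $$b_n = q^{2n-1}\ (n\ge 1),\qquad c_n = t q^{2n}\ (n\ge 0).$$ Then the linear functional $\mathcal{F}$ for $P_n(z)$, normalized by $\mathcal{F}[z]=\kappa$, has moments $f_k=\mathcal{F}[z^k]$ described by the $q$-Narayana polynomials: $$f_k = \kappa\, N_{k-1}(t,q) \quad\text{for } k\ge 1,\qquad f_k = \kappa\, t^{ -2|k|-1} N_{|k|}(t,q^{ -1})\quad\text{for } k\le 0.$$
   Context: $\mathbb{N}=\{0,1,2,\ldots\}$. For nonzero constants $b_n$ ($n\ge1$), $c_n$ ($n\ge 0$), the polynomials $P_n(z)$ defined by the recurrence are called (monic) Laurent biorthogonal polynomials. There is a linear functional $\mathcal{F}$ on Laurent polynomials in $z$, unique up to a constant factor, such that $\mathcal{F}[P_n(z)z^{ -k}]=h_n\delta_{n,k}$ for $0\le k\le n$ with some constants $h_n\ne 0$; this is "the linear functional for $P_n(z)$", and it is fixed by prescribing $\mathcal{F}[z]=\kappa$ with $\kappa\neq0$. A Schröder path is a lattice path in $\mathbb{Z}^2$ consisting of up steps $(1,1)$, down steps $(1,-1)$ and level steps $(2,0)$, never going beneath the $x$-axis (the path without steps is allowed). $S_k$ is the set of Schröder paths from $(0,0)$ to $(2k,0)$.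 $\mathrm{level}(P)$ is the number of level steps of $P$ and $\mathrm{area}(P)$ is the area of the region between $P$ and the $x$-axis. The $q$-Narayana polynomials are $N_k(t,q)=\sum_{P\in S_k} t^{\mathrm{level}(P)} q^{\mathrm{area}(P)}$, $k\in\mathbb{N}$. -}

module Defs where

open import Algebra.Apartness.Bundles using (HeytingField; HeytingCommutativeRing)
open import Algebra.Bundles using (CommutativeRing)
open import Algebra.Module.Bundles.Raw using (RawLeftModule)
import Algebra.Apartness.Properties.HeytingCommutativeRing as HeytingProperties
import Algebra.Module.Construct.TensorUnit as TensorUnit
import Algebra.Module.Morphism.Structures as ModuleMorphisms
import Algebra.Properties.Semiring.Exp as Exp
open import Data.Integer.Base as ℤ using (ℤ; +_; 0ℤ; 1ℤ)
import Data.Integer.Properties as ℤ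
open import Data.List.Base
  using (List; []; _∷_; [_]; _++_; map; foldr; cartesianProductWith)
open import Data.List.Membership.Propositional using (_∈_)
open import Data.List.Membership.Propositional.Properties
  using (∈-map⁺; ∈-map⁻; ∈-++⁺ˡ; ∈-++⁺ʳ; ∈-++⁻)
open import Data.List.Relation.Unary.Any using (here)
open import Data.List.Relation.Unary.All using ([])
open import Data.List.Relation.Unary.AllPairs using ([]; _∷_)
open import Data.List.Relation.Unary.Unique.Propositional using (Unique)
import Data.List.Relation.Unary.Unique.Propositional.Properties as Unique
open import Data.Nat.Base as ℕ using (ℕ; zero; suc; ⌊_/2⌋)
import Data.Nat.Properties as ℕ
open import Data.Nat.Tactic.RingSolver using (solve-∀)
open import Data.Product.Base using (_×_; _,_; proj₁; proj₂; ∃-syntax)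
open import Data.Sum.Base using (inj₁; inj₂)
open import Function.Base using (_∘_)
open import Level using (_⊔_)
open import Relation.Binary.PropositionalEquality
  using (_≡_; refl; sym; trans; cong)
open import Relation.Nullary.Decidable using (does)
open import Relation.Nullary.Negation using (¬_)
open import Data.Bool.Base using (if_then_else_)

------------------------------------------------------------------------
-- Schröder paths

-- Path n y: paths from a point (x , y) to (x + n , 0) which stay weakly
-- above the x-axis.  Heights are natural numbers, so a down step can only
-- be taken from a positive height.

data Path : ℕ → ℕ → Set where
  []    : Path 0 0
  up    : ∀ {n y} → Path n (suc y) → Path (suc n) y
  down  : ∀ {n y} → Path n y → Path (suc n) (suc y)
  level : ∀ {n y} → Path n y → Path (suc (suc n)) y

SchröderPath : ℕ → Set
SchröderPath k = Path (2 ℕ.* k) 0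

levels : ∀ {n y} → Path n y → ℕ
levels []        = 0
levels (up p)    = levels p
levels (down p)  = levels p
levels (level p) = suc (levels p)

-- Below a single step lies a trapezoid, whose doubled area is its width
-- times the sum of the heights of the two endpoints.

doubleArea : ∀ {n y} → Path n y → ℕ
doubleArea []                = 0
doubleArea (up {y = y} p)    = 1 ℕ.* (y ℕ.+ suc y) ℕ.+ doubleArea p
doubleArea (down {y = y} p)  = 1 ℕ.* (suc y ℕ.+ y) ℕ.+ doubleArea p
doubleArea (level {y = y} p) = 2 ℕ.* (y ℕ.+ y) ℕ.+ doubleArea p

-- The halving is exact on Schröder paths, see 2*area below.

area : ∀ {k} → SchröderPath k → ℕ
area {k} p = ⌊ doubleArea p /2⌋

private
  doubleArea-parity : ∀ {n y} (p : Path n y) →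
                      ∃[ m ] doubleArea p ≡ y ℕ.+ 2 ℕ.* m
  doubleArea-parity [] = 0 , refl
  doubleArea-parity (up {y = y} p) with doubleArea p | doubleArea-parity p
  ... | _ | m , refl = suc (y ℕ.+ m) , lemma y m
    where
    lemma : ∀ y m → 1 ℕ.* (y ℕ.+ suc y) ℕ.+ (suc y ℕ.+ 2 ℕ.* m)
                  ≡ y ℕ.+ 2 ℕ.* suc (y ℕ.+ m)
    lemma = solve-∀
  doubleArea-parity (down {y = y} p) with doubleArea p | doubleArea-parity p
  ... | _ | m , refl = y ℕ.+ m , lemma y m
    where
    lemma : ∀ y m → 1 ℕ.* (suc y ℕ.+ y) ℕ.+ (y ℕ.+ 2 ℕ.* m)
                  ≡ suc y ℕ.+ 2 ℕ.* (y ℕ.+ m)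
    lemma = solve-∀
  doubleArea-parity (level {y = y} p) with doubleArea p | doubleArea-parity p
  ... | _ | m , refl = y ℕ.+ y ℕ.+ m , lemma y m
    where
    lemma : ∀ y m → 2 ℕ.* (y ℕ.+ y) ℕ.+ (y ℕ.+ 2 ℕ.* m)
                  ≡ y ℕ.+ 2 ℕ.* (y ℕ.+ y ℕ.+ m)
    lemma = solve-∀

2*area : ∀ {k} (p : SchröderPath k) → 2 ℕ.* area {k} p ≡ doubleArea p
2*area p with doubleArea p | doubleArea-parity p
... | _ | m , refl = cong (2 ℕ.*_) (halve m)
  where
  halve : ∀ m → ⌊ 2 ℕ.* m /2⌋ ≡ m
  halve m = trans (cong (λ x → ⌊ m ℕ.+ x /2⌋) (ℕ.+-identityʳ m))
                  (sym (ℕ.n≡⌊n+n/2⌋ m))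

-- Each path occurs exactly once in this list, see ∈-paths and
-- paths-unique below.

mutual
  paths : ∀ n y → List (Path n y)
  paths zero    zero    = [ [] ]
  paths zero    (suc y) = []
  paths (suc n) y       = upPaths n y ++ downPaths n y ++ levelPaths n y

  upPaths : ∀ n y → List (Path (suc n) y)
  upPaths n y = map up (paths n (suc y))

  downPaths : ∀ n y → List (Path (suc n) y)
  downPaths n zero    = []
  downPaths n (suc y) = map down (paths n y)

  levelPaths : ∀ n y → List (Path (suc n) y)
  levelPaths zero    y = []
  levelPaths (suc n) y = map level (paths n y)

schröderPaths : ∀ k → List (SchröderPath k)
schröderPaths k = paths (2 ℕ.* k) 0

∈-paths : ∀ {n y} (p : Path n y) → p ∈ paths n y
∈-paths [] = here refl
∈-paths (up p) = ∈-++⁺ˡ (∈-map⁺ up (∈-paths p))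
∈-paths (down {n} {y} p) =
  ∈-++⁺ʳ (upPaths n (suc y)) (∈-++⁺ˡ (∈-map⁺ down (∈-paths p)))
∈-paths (level {n} {y} p) =
  ∈-++⁺ʳ (upPaths (suc n) y)
    (∈-++⁺ʳ (downPaths (suc n) y) (∈-map⁺ level (∈-paths p)))

private
  up∉down : ∀ n y {p : Path n (suc y)} → ¬ (up p ∈ downPaths n y)
  up∉down n (suc y) up∈ with () ← proj₂ (proj₂ (∈-map⁻ down up∈))

  up∉level : ∀ n y {p : Path n (suc y)} → ¬ (up p ∈ levelPaths n y)
  up∉level (suc n) y up∈ with () ← proj₂ (proj₂ (∈-map⁻ level up∈))

  down∉level : ∀ n y {p : Path n y} → ¬ (down p ∈ levelPaths n (suc y))
  down∉level (suc n) y down∈ with () ← proj₂ (proj₂ (∈-map⁻ level down∈))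

paths-unique : ∀ n y → Unique (paths n y)
paths-unique zero    zero    = [] ∷ []
paths-unique zero    (suc y) = []
paths-unique (suc n) y       =
  Unique.++⁺ (Unique.map⁺ (λ { refl → refl }) (paths-unique n (suc y)))
    (Unique.++⁺ (unique-down y) (unique-level n) (down#level y))
    up#rest
  where
  unique-down : ∀ y → Unique (downPaths n y)
  unique-down zero    = []
  unique-down (suc y) = Unique.map⁺ (λ { refl → refl }) (paths-unique n y)

  unique-level : ∀ n → Unique (levelPaths n y)
  unique-level zero    = []
  unique-level (suc n) = Unique.map⁺ (λ { refl → refl }) (paths-unique n y)

  down#level : ∀ y {p} → ¬ (p ∈ downPaths n y × p ∈ levelPaths n y)
  down#level (suc y) (∈d , ∈l) with ∈-map⁻ down ∈d
  ... | _ , _ , refl = down∉level n y ∈l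

  up#rest : ∀ {p} → ¬ (p ∈ upPaths n y × p ∈ downPaths n y ++ levelPaths n y)
  up#rest (∈u , ∈r) with ∈-map⁻ up ∈u | ∈-++⁻ (downPaths n y) ∈r
  ... | _ , _ , refl | inj₁ ∈d = up∉down n y ∈d
  ... | _ , _ , refl | inj₂ ∈l = up∉level n y ∈l

------------------------------------------------------------------------
-- Laurent polynomials over a field; "nonzero" is apartness from 0#

module LaurentBiorthogonal {c ℓ₁ ℓ₂} (K : HeytingField c ℓ₁ ℓ₂) where

  open HeytingField K hiding (refl; sym; trans)
  open HeytingCommutativeRing heytingCommutativeRing using (commutativeRing)
  open CommutativeRing commutativeRing using (rawRing; semiring)
  open Exp semiring using (_^_) public

  inverse : ∀ {x} → x # 0# → Carrier
  inverse x#0 = proj₁ (#⇒invertible x#0)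

  -- #⇒invertible inverts x - 0#, which is x.

  inverseˡ : ∀ {x} (x#0 : x # 0#) → inverse x#0 * x ≈ 1#
  inverseˡ {x} x#0 =
    HeytingField.trans K
      (*-congˡ (HeytingField.sym K (HeytingProperties.x-0≈x heytingCommutativeRing x)))
      (proj₁ (proj₂ (#⇒invertible x#0)))

  qNarayana : ℕ → Carrier → Carrier → Carrier
  qNarayana k t q =
    foldr _+_ 0# (map (λ p → t ^ levels p * q ^ area {k} p) (schröderPaths k))

  -- The list of the terms a zᵉ, as pairs (a , e), in any order and possibly
  -- with repeated exponents; two lists are identified by _≈ᴸ_ when all their
  -- collected coefficients agree.

  Laurent : Set c
  Laurent = List (Carrier × ℤ)

  coeff : Laurent → ℤ → Carrier
  coeff []            k = 0#
  coeff ((a , e) ∷ p) k = (if does (e ℤ.≟ k) then a else 0#) + coeff p k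

  infix  4 _≈ᴸ_
  infixl 6 _-ᴸ_
  infixl 7 _*ᴸ_

  _≈ᴸ_ : Laurent → Laurent → Set ℓ₁
  p ≈ᴸ r = ∀ k → coeff p k ≈ coeff r k

  -ᴸ_ : Laurent → Laurent
  -ᴸ_ = map (λ (a , e) → - a , e)

  _-ᴸ_ : Laurent → Laurent → Laurent
  p -ᴸ r = p ++ (-ᴸ r)

  _*ᴸ_ : Laurent → Laurent → Laurent
  _*ᴸ_ = cartesianProductWith (λ (a , e) (b , f) → a * b , e ℤ.+ f)

  const : Carrier → Laurent
  const a = [ (a , 0ℤ) ]

  z^_ : ℤ → Laurent
  z^ k = [ (1# , k) ]

  z : Laurent
  z = z^ 1ℤ

  laurent : RawLeftModule Carrier c ℓ₁
  laurent = record
    { Carrierᴹ = Laurent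
    ; _≈ᴹ_     = _≈ᴸ_
    ; _+ᴹ_     = _++_
    ; _*ₗ_     = λ s → map (λ (a , e) → s * a , e)
    ; 0ᴹ       = []
    ; -ᴹ_      = -ᴸ_
    }

  open ModuleMorphisms.LeftModuleMorphisms
         laurent (TensorUnit.rawLeftModule {R = rawRing})
    using () renaming (IsLeftModuleHomomorphism to IsLinearFunctional) public

  -- The value b 0 is not used.

  lbp : (b c : ℕ → Carrier) → ℕ → Laurent
  lbp b c zero          = const 1#
  lbp b c (suc zero)    = z -ᴸ const (c 0)
  lbp b c (suc (suc n)) =
    (z -ᴸ const (c (suc n))) *ᴸ lbp b c (suc n)
      -ᴸ const (b (suc n)) *ᴸ z *ᴸ lbp b c n

  δ : ℕ → ℕ → Carrier
  δ n k = if does (n ℕ.≟ k) then 1# else 0#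

  record IsFunctionalFor (P : ℕ → Laurent) (F : Laurent → Carrier)
         : Set (c ⊔ ℓ₁ ⊔ ℓ₂) where
    field
      isLinearFunctional : IsLinearFunctional F
      h                  : ℕ → Carrier
      h#0                : ∀ n → h n # 0#
      biorthogonal       : ∀ n k → k ℕ.≤ n →
                           F (P n *ᴸ z^ (ℤ.- (+ k))) ≈ h n * δ n k

{-# OPTIONS --safe #-}
-- Write G(m, n) = F[zᵐ Pₙ].  The recurrence of the Pₙ becomes
--   G(m+1, n) = G(m, n+1) + bₙ G(m+1, n-1) + cₙ G(m, n),
-- which is the first-step decomposition of a weighted sum over paths starting
-- at height n: up steps have weight 1, down steps from height n weight bₙ, and
-- level steps at height n weight cₙ.  By biorthogonality G(0, n) = 0 for n ≥ 1,
-- so G(m+1, n) is G(1, 0) times that sum.  For bₙ = q²ⁿ⁻¹ and cₙ = t q²ⁿ the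
-- powers of q in the weights add up to the area of the path.
--
-- For the moments with k ≤ 0, the numbers t²ᵐ Eₙ F[z¹⁻ᵐ⁻ⁿ Pₙ] with
-- Eₙ = (-t)ⁿ q^(-n(n-1)) satisfy the same recurrence with q⁻¹ in place of q,
-- and again vanish for m = 0, n ≥ 1 (this is the passage to the reciprocal
-- polynomials zⁿ Pₙ(z⁻¹)).
module Submission where

open import Defs
open import Algebra.Apartness.Bundles
  using (HeytingField; HeytingCommutativeRing)
open import Algebra.Bundles using (CommutativeRing)
import Algebra.Properties.CommutativeSemiring.Exp as ExpProperties
import Algebra.Properties.Ring as RingProperties
import Algebra.Solver.Ring.NaturalCoefficients.Default as SemiringSolver
open import Data.Bool.Base using (true; false)
open import Data.Integer.Base as ℤ using (ℤ; +_; -[1+_]; 0ℤ; 1ℤ; ∣_∣)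
import Data.Integer.Properties as ℤ
open import Data.List.Base using (List; []; _∷_; [_]; _++_; map; foldr)
open import Data.Nat.Base as ℕ using (ℕ; zero; suc; _∸_; z≤n; s≤s)
import Data.Nat.Properties as ℕ
open import Data.Nat.Tactic.RingSolver using (solve-∀)
open import Data.Product.Base using (_×_; _,_)
open import Function.Base using (_∘_)
open import Relation.Binary.PropositionalEquality as ≡ using (_≡_)
import Relation.Binary.Reasoning.Setoid as SetoidReasoning
open import Relation.Nullary.Decidable using (does; dec-false)

-- Heights and areas of lattice paths

-- The height drops by at most one per unit of width, so from height `y` the axis is out of reach.
paths-short : ∀ n y → n ℕ.< y → paths n y ≡ []
paths-short zero          (suc y) _         = ≡.refl
paths-short (suc zero)    (suc y) (s≤s n<y) =
  ≡.cong (λ ps → map down ps ++ []) (paths-short zero y n<y)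
paths-short (suc (suc n)) (suc y) (s≤s n<y) = ≡.cong₂ _++_
  (≡.cong (map up) (paths-short (suc n) (suc (suc y))
    (ℕ.m<n⇒m<1+n (ℕ.m<n⇒m<1+n n<y))))
  (≡.cong₂ _++_
    (≡.cong (map down) (paths-short (suc n) y n<y))
    (≡.cong (map level) (paths-short n (suc y)
      (ℕ.m<n⇒m<1+n (ℕ.<-trans (ℕ.n<1+n n) n<y)))))

-- The area below the path once it is extended to the left, down to the
-- x-axis, by y up steps.

extendedArea : ∀ {n y} → Path n y → ℕ
extendedArea []                = 0
extendedArea (up p)            = extendedArea p
extendedArea (down {y = y} p)  = (2 ℕ.* suc y ∸ 1) ℕ.+ extendedArea p
extendedArea (level {y = y} p) = 2 ℕ.* y ℕ.+ extendedArea p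

-- The added up steps bound a right triangle with both legs `y`, hence of doubled area `y * y`.
2*extendedArea : ∀ {n y} (p : Path n y) →
                 2 ℕ.* extendedArea p ≡ doubleArea p ℕ.+ y ℕ.* y
2*extendedArea [] = ≡.refl
2*extendedArea (up {y = y} p) = ≡.trans (2*extendedArea p) (rearrange y _)
  where
  rearrange : ∀ y d → d ℕ.+ suc y ℕ.* suc y
                    ≡ 1 ℕ.* (y ℕ.+ suc y) ℕ.+ d ℕ.+ y ℕ.* y
  rearrange = solve-∀
2*extendedArea (down {y = y} p) = begin
  2 ℕ.* ((2 ℕ.* suc y ∸ 1) ℕ.+ extendedArea p)
    ≡⟨ distribute y (extendedArea p) ⟩
  2 ℕ.* (y ℕ.+ suc y) ℕ.+ 2 ℕ.* extendedArea p
    ≡⟨ ≡.cong (2 ℕ.* (y ℕ.+ suc y) ℕ.+_) (2*extendedArea p) ⟩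
  2 ℕ.* (y ℕ.+ suc y) ℕ.+ (doubleArea p ℕ.+ y ℕ.* y)
    ≡⟨ rearrange y (doubleArea p) ⟩
  1 ℕ.* (suc y ℕ.+ y) ℕ.+ doubleArea p ℕ.+ suc y ℕ.* suc y ∎
  where
  open ≡.≡-Reasoning
  distribute : ∀ y a → 2 ℕ.* ((y ℕ.+ suc (y ℕ.+ 0)) ℕ.+ a)
                     ≡ 2 ℕ.* (y ℕ.+ suc y) ℕ.+ 2 ℕ.* a
  distribute = solve-∀
  rearrange : ∀ y d → 2 ℕ.* (y ℕ.+ suc y) ℕ.+ (d ℕ.+ y ℕ.* y)
                    ≡ 1 ℕ.* (suc y ℕ.+ y) ℕ.+ d ℕ.+ suc y ℕ.* suc y
  rearrange = solve-∀
2*extendedArea (level {y = y} p) = begin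
  2 ℕ.* (2 ℕ.* y ℕ.+ extendedArea p)
    ≡⟨ ℕ.*-distribˡ-+ 2 (2 ℕ.* y) (extendedArea p) ⟩
  2 ℕ.* (2 ℕ.* y) ℕ.+ 2 ℕ.* extendedArea p
    ≡⟨ ≡.cong (2 ℕ.* (2 ℕ.* y) ℕ.+_) (2*extendedArea p) ⟩
  2 ℕ.* (2 ℕ.* y) ℕ.+ (doubleArea p ℕ.+ y ℕ.* y)
    ≡⟨ rearrange y (doubleArea p) ⟩
  2 ℕ.* (y ℕ.+ y) ℕ.+ doubleArea p ℕ.+ y ℕ.* y ∎
  where
  open ≡.≡-Reasoning
  rearrange : ∀ y d → 2 ℕ.* (2 ℕ.* y) ℕ.+ (d ℕ.+ y ℕ.* y)
                    ≡ 2 ℕ.* (y ℕ.+ y) ℕ.+ d ℕ.+ y ℕ.* y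
  rearrange = solve-∀

extendedArea-area : ∀ k (p : SchröderPath k) → extendedArea p ≡ area {k} p
extendedArea-area k p = ℕ.*-cancelˡ-≡ _ _ 2
  (≡.trans (2*extendedArea p)
    (≡.trans (ℕ.+-identityʳ _) (≡.sym (2*area {k} p))))

module _ {c ℓ₁ ℓ₂} (K : HeytingField c ℓ₁ ℓ₂) where

  open HeytingField K hiding (zero)
  open HeytingCommutativeRing heytingCommutativeRing using (commutativeRing)
  open CommutativeRing commutativeRing using (commutativeSemiring; ring)
  open LaurentBiorthogonal K
  open ExpProperties commutativeSemiring using (^-congˡ; ^-homo-*; ^-distrib-*)
  open RingProperties ring
    using (-‿distribˡ-*; -‿distribʳ-*; -‿involutive; -0#≈0#; -‿+-comm;
           //-rightDividesˡ)
  open SemiringSolver commutativeSemiring using (solve; _:*_; _:+_; _:=_)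
  open SetoidReasoning setoid

  -- Field identities and finite sums

  x*y≈1⇒x^n*y^n≈1 : ∀ {x y} → x * y ≈ 1# → ∀ n → x ^ n * y ^ n ≈ 1#
  x*y≈1⇒x^n*y^n≈1 {x} {y} xy≈1 n = begin
    x ^ n * y ^ n  ≈⟨ ^-distrib-* x y n ⟨
    (x * y) ^ n    ≈⟨ ^-congˡ n xy≈1 ⟩
    1# ^ n         ≈⟨ 1^n n ⟩
    1#             ∎
    where
    1^n : ∀ n → 1# ^ n ≈ 1#
    1^n zero    = refl
    1^n (suc n) = trans (*-identityˡ _) (1^n n)

  -x*-y≈x*y : ∀ x y → - x * - y ≈ x * y
  -x*-y≈x*y x y = begin
    - x * - y      ≈⟨ -‿distribˡ-* x (- y) ⟨
    - (x * - y)    ≈⟨ -‿cong (-‿distribʳ-* x y) ⟨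
    - (- (x * y))  ≈⟨ -‿involutive (x * y) ⟩
    x * y          ∎

  sumOver : ∀ {a} {A : Set a} → (A → Carrier) → List A → Carrier
  sumOver f xs = foldr _+_ 0# (map f xs)

  module _ {a} {A : Set a} (f : A → Carrier) where

    sumOver-++ : ∀ xs ys → sumOver f (xs ++ ys) ≈ sumOver f xs + sumOver f ys
    sumOver-++ []       ys = sym (+-identityˡ _)
    sumOver-++ (x ∷ xs) ys =
      trans (+-congˡ (sumOver-++ xs ys)) (sym (+-assoc _ _ _))

    sumOver-map : ∀ {b} {B : Set b} {g : B → A} {h : B → Carrier} s →
                  (∀ x → f (g x) ≈ s * h x) →
                  ∀ xs → sumOver f (map g xs) ≈ s * sumOver h xs
    sumOver-map s eq []       = sym (zeroʳ s)
    sumOver-map s eq (x ∷ xs) =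
      trans (+-cong (eq x) (sumOver-map s eq xs)) (sym (distribˡ s _ _))

    sumOver-cong : ∀ {g} → (∀ x → f x ≈ g x) →
                   ∀ xs → sumOver f xs ≈ sumOver g xs
    sumOver-cong eq []       = refl
    sumOver-cong eq (x ∷ xs) = +-cong (eq x) (sumOver-cong eq xs)

  -- Weighted path sums and their first-step decomposition

  module PathSum (t q : Carrier) where

    -- Measuring by `extendedArea` gives each step a factor of its own: 1 for up, q^(2n-1) for down
    -- from height n, t q^(2n) for level at height n. For paths starting on the axis it agrees with
    -- `area`.
    weight : ∀ {n y} → Path n y → Carrier
    weight p = t ^ levels p * q ^ extendedArea p

    pathSum : ℕ → ℕ → Carrier
    pathSum n y = sumOver weight (paths n y)

    pathSum-short : ∀ {n y} → n ℕ.< y → pathSum n y ≈ 0#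
    pathSum-short {n} {y} n<y rewrite paths-short n y n<y = refl

    qNarayana-pathSum : ∀ k → pathSum (2 ℕ.* k) 0 ≈ qNarayana k t q
    qNarayana-pathSum k = sumOver-cong weight
      (λ p → *-congˡ (reflexive (≡.cong (q ^_) (extendedArea-area k p))))
      (schröderPaths k)

    private
      up-sum : ∀ n y → sumOver weight (upPaths n y) ≈ pathSum n (suc y)
      up-sum n y = trans
        (sumOver-map weight 1# (λ p → sym (*-identityˡ _)) (paths n (suc y)))
        (*-identityˡ _)

      down-sum : ∀ n y → sumOver weight (downPaths n (suc y))
                       ≈ q ^ (2 ℕ.* suc y ∸ 1) * pathSum n y
      down-sum n y = sumOver-map weight _ eq (paths n y)
        where
        eq : ∀ p → weight (down p) ≈ q ^ (2 ℕ.* suc y ∸ 1) * weight p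
        eq p = trans
          (*-congˡ (^-homo-* q (2 ℕ.* suc y ∸ 1) (extendedArea p)))
          (solve 3 (λ a b c → a :* (b :* c) := b :* (a :* c)) refl _ _ _)

      level-sum : ∀ n y → sumOver weight (levelPaths (suc n) y)
                        ≈ t * q ^ (2 ℕ.* y) * pathSum n y
      level-sum n y = sumOver-map weight _ eq (paths n y)
        where
        eq : ∀ p → weight (level p) ≈ t * q ^ (2 ℕ.* y) * weight p
        eq p = trans
          (*-congˡ (^-homo-* q (2 ℕ.* y) (extendedArea p)))
          (solve 4 (λ t a b c → t :* a :* (b :* c) := t :* b :* (a :* c))
            refl _ _ _ _)

      first-step : ∀ n y → pathSum (suc n) y
                         ≈ pathSum n (suc y)
                           + (sumOver weight (downPaths n y)
                              + sumOver weight (levelPaths n y))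
      first-step n y = trans
        (sumOver-++ weight (upPaths n y) _)
        (+-cong (up-sum n y) (sumOver-++ weight (downPaths n y) _))

    -- No down step leaves height 0, so `downPaths` contributes an empty sum.
    pathSum-ground : ∀ n → pathSum (suc (suc n)) 0
                         ≈ pathSum (suc n) 1 + t * q ^ 0 * pathSum n 0
    pathSum-ground n = trans (first-step (suc n) 0)
      (+-congˡ (trans (+-identityˡ _) (level-sum n 0)))

    pathSum-raised : ∀ n y → pathSum (suc (suc n)) (suc y)
                           ≈ pathSum (suc n) (suc (suc y))
                             + (q ^ (2 ℕ.* suc y ∸ 1) * pathSum (suc n) y
                                + t * q ^ (2 ℕ.* suc y) * pathSum n (suc y))
    pathSum-raised n y = trans (first-step (suc n) (suc y))
      (+-congˡ (+-cong (down-sum (suc n) y) (level-sum n (suc y))))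

    -- When the width equals the height, only the straight descent reaches the axis: an up or level
    -- step leaves a width smaller than the remaining height.
    pathSum-descent : ∀ y → pathSum (suc y) (suc y)
                          ≈ q ^ (2 ℕ.* suc y ∸ 1) * pathSum y y
    pathSum-descent y = begin
      pathSum (suc y) (suc y)
        ≈⟨ first-step y (suc y) ⟩
      pathSum y (suc (suc y)) + (_ + sumOver weight (levelPaths y (suc y)))
        ≈⟨ +-cong (pathSum-short (s≤s (ℕ.n≤1+n y)))
                  (+-cong (down-sum y y) (no-level y)) ⟩
      0# + (q ^ (2 ℕ.* suc y ∸ 1) * pathSum y y + 0#)
        ≈⟨ trans (+-identityˡ _) (+-identityʳ _) ⟩
      q ^ (2 ℕ.* suc y ∸ 1) * pathSum y y ∎
      where
      no-level : ∀ y → sumOver weight (levelPaths y (suc y)) ≈ 0#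
      no-level zero    = refl
      no-level (suc n) = trans (level-sum n (suc (suc n)))
        (trans (*-congˡ (pathSum-short (s≤s (ℕ.n≤1+n n)))) (zeroʳ _))

  -- The recurrence and its solution by path sums

  -- These conditions determine every `G (suc m) y` from the single value `G 1 0`. Both signs of the
  -- moments are reduced to them.
  record Recurrence (t q : Carrier) (G : ℕ → ℕ → Carrier) : Set ℓ₁ where
    field
      vanish : ∀ y → G 0 (suc y) ≈ 0#
      ground : ∀ m → G (suc m) 0 ≈ G m 1 + t * q ^ 0 * G m 0
      raised : ∀ m y → G (suc m) (suc y)
                     ≈ G m (suc (suc y))
                       + (q ^ (2 ℕ.* suc y ∸ 1) * G (suc m) y
                          + t * q ^ (2 ℕ.* suc y) * G m (suc y))

  module _ {t q : Carrier} {G : ℕ → ℕ → Carrier}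
           (recurrence : Recurrence t q G) where

    open Recurrence recurrence
    open PathSum t q

    -- The index `m` counts up and level steps: with u ups, l levels and hence u + y downs, the
    -- width is 2(u + l) + y. An up or level step lowers `m`, while a down step keeps `m` and lowers
    -- `y`, so the induction is lexicographic.
    recurrence-pathSum : ∀ m y →
                         G (suc m) y ≈ G 1 0 * pathSum (m ℕ.* 2 ℕ.+ y) y
    recurrence-pathSum zero zero = begin
      G 1 0                    ≈⟨ *-identityʳ _ ⟨
      G 1 0 * 1#               ≈⟨ *-congˡ (trans (+-identityʳ _) (*-identityˡ _)) ⟨
      G 1 0 * pathSum 0 0      ∎
    recurrence-pathSum zero (suc y) = begin
      G 1 (suc y)
        ≈⟨ raised 0 y ⟩
      G 0 (suc (suc y)) + (w * G 1 y + x * G 0 (suc y))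
        -- The up and level terms have first index 0 and vanish, which matches the forced descent of
        -- a path without up and level steps.
        ≈⟨ +-cong (vanish (suc y))
                  (+-congˡ (trans (*-congˡ (vanish y)) (zeroʳ x))) ⟩
      0# + (w * G 1 y + 0#)
        ≈⟨ trans (+-identityˡ _) (+-identityʳ _) ⟩
      w * G 1 y
        ≈⟨ *-congˡ (recurrence-pathSum zero y) ⟩
      w * (G 1 0 * pathSum y y)
        ≈⟨ solve 3 (λ a b c → a :* (b :* c) := b :* (a :* c)) refl _ _ _ ⟩
      G 1 0 * (w * pathSum y y)
        ≈⟨ *-congˡ (pathSum-descent y) ⟨
      G 1 0 * pathSum (suc y) (suc y) ∎
      where
      w x : Carrier
      w = q ^ (2 ℕ.* suc y ∸ 1)
      x = t * q ^ (2 ℕ.* suc y)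
    recurrence-pathSum (suc m) zero = begin
      G (suc (suc m)) 0
        ≈⟨ ground (suc m) ⟩
      G (suc m) 1 + x * G (suc m) 0
        ≈⟨ +-cong (recurrence-pathSum m 1)
                  (*-congˡ (recurrence-pathSum m 0)) ⟩
      g * pathSum (m ℕ.* 2 ℕ.+ 1) 1 + x * (g * pathSum l 0)
        ≈⟨ +-congʳ (*-congˡ (reflexive
             (≡.cong (λ n → pathSum n 1) (ℕ.+-suc (m ℕ.* 2) 0)))) ⟩
      g * pathSum (suc l) 1 + x * (g * pathSum l 0)
        ≈⟨ solve 4 (λ g a x b → g :* a :+ x :* (g :* b)
                              := g :* (a :+ x :* b)) refl _ _ _ _ ⟩
      g * (pathSum (suc l) 1 + x * pathSum l 0)
        ≈⟨ *-congˡ (pathSum-ground l) ⟨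
      g * pathSum (suc (suc l)) 0 ∎
      where
      l : ℕ
      l = m ℕ.* 2 ℕ.+ 0
      g x : Carrier
      g = G 1 0
      x = t * q ^ 0
    recurrence-pathSum (suc m) (suc y) = begin
      G (suc (suc m)) (suc y)
        ≈⟨ raised (suc m) y ⟩
      G (suc m) (suc (suc y)) + (w * G (suc (suc m)) y + x * G (suc m) (suc y))
        ≈⟨ +-cong (recurrence-pathSum m (suc (suc y)))
             (+-cong (*-congˡ (recurrence-pathSum (suc m) y))
                     (*-congˡ (recurrence-pathSum m (suc y)))) ⟩
      g * pathSum (m ℕ.* 2 ℕ.+ suc (suc y)) (suc (suc y))
        + (w * (g * pathSum (suc (suc (m ℕ.* 2 ℕ.+ y))) y)
           + x * (g * pathSum l (suc y)))
        ≈⟨ +-cong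
             (*-congˡ (reflexive
               (≡.cong (λ n → pathSum n (suc (suc y)))
                 (ℕ.+-suc (m ℕ.* 2) (suc y)))))
             (+-congʳ (*-congˡ (*-congˡ (reflexive
               (≡.cong (λ n → pathSum (suc n) y)
                 (≡.sym (ℕ.+-suc (m ℕ.* 2) y))))))) ⟩
      g * pathSum (suc l) (suc (suc y))
        + (w * (g * pathSum (suc l) y) + x * (g * pathSum l (suc y)))
        ≈⟨ solve 6 (λ g a w b x c → g :* a :+ (w :* (g :* b) :+ x :* (g :* c))
                                  := g :* (a :+ (w :* b :+ x :* c)))
             refl _ _ _ _ _ _ ⟩
      g * (pathSum (suc l) (suc (suc y))
           + (w * pathSum (suc l) y + x * pathSum l (suc y)))
        ≈⟨ *-congˡ (pathSum-raised l y) ⟨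
      g * pathSum (suc (suc l)) (suc y) ∎
      where
      l : ℕ
      l = m ℕ.* 2 ℕ.+ suc y
      g w x : Carrier
      g = G 1 0
      w = q ^ (2 ℕ.* suc y ∸ 1)
      x = t * q ^ (2 ℕ.* suc y)

    recurrence-qNarayana : ∀ m → G (suc m) 0 ≈ G 1 0 * qNarayana m t q
    recurrence-qNarayana m = begin
      G (suc m) 0
        ≈⟨ recurrence-pathSum m 0 ⟩
      G 1 0 * pathSum (m ℕ.* 2 ℕ.+ 0) 0
        ≈⟨ *-congˡ (reflexive (≡.cong (λ n → pathSum n 0)
             (≡.trans (ℕ.+-identityʳ _) (ℕ.*-comm m 2)))) ⟩
      G 1 0 * pathSum (2 ℕ.* m) 0
        ≈⟨ *-congˡ (qNarayana-pathSum m) ⟩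
      G 1 0 * qNarayana m t q ∎

  -- Evaluation of Laurent polynomials through moments

  -- shifted f p k is the value at zᵏ p of the linear functional with
  -- moments f.

  shifted : (ℤ → Carrier) → Laurent → ℤ → Carrier
  shifted f []            k = 0#
  shifted f ((a , e) ∷ p) k = a * f (e ℤ.+ k) + shifted f p k

  module _ (f : ℤ → Carrier) where

    shifted-++ : ∀ p r k → shifted f (p ++ r) k ≈ shifted f p k + shifted f r k
    shifted-++ []            r k = sym (+-identityˡ _)
    shifted-++ ((a , e) ∷ p) r k =
      trans (+-congˡ (shifted-++ p r k)) (sym (+-assoc _ _ _))

    shifted-neg : ∀ p k → shifted f (-ᴸ p) k ≈ - shifted f p k
    shifted-neg []            k = sym -0#≈0#
    shifted-neg ((a , e) ∷ p) k =
      trans (+-cong (sym (-‿distribˡ-* a _)) (shifted-neg p k)) (-‿+-comm _ _)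

    shifted-term : ∀ a e p k →
                   shifted f ([ (a , e) ] *ᴸ p) k ≈ a * shifted f p (e ℤ.+ k)
    shifted-term a e []            k = sym (zeroʳ a)
    shifted-term a e ((b , d) ∷ p) k = begin
      a * b * f ((e ℤ.+ d) ℤ.+ k) + shifted f ([ (a , e) ] *ᴸ p) k
        ≈⟨ +-cong (trans (*-assoc _ _ _) (*-congˡ (*-congˡ
             (reflexive (≡.cong f exponent))))) (shifted-term a e p k) ⟩
      a * (b * f (d ℤ.+ (e ℤ.+ k))) + a * shifted f p (e ℤ.+ k)
        ≈⟨ distribˡ _ _ _ ⟨
      a * (b * f (d ℤ.+ (e ℤ.+ k)) + shifted f p (e ℤ.+ k)) ∎
      where
      exponent : (e ℤ.+ d) ℤ.+ k ≡ d ℤ.+ (e ℤ.+ k)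
      exponent = ≡.trans (≡.cong (ℤ._+ k) (ℤ.+-comm e d)) (ℤ.+-assoc d e k)

    shifted-* : ∀ a e p r k → shifted f (((a , e) ∷ p) *ᴸ r) k
                            ≈ a * shifted f r (e ℤ.+ k) + shifted f (p *ᴸ r) k
    shifted-* a e p r k = begin
      shifted f (row ++ p *ᴸ r) k              ≈⟨ shifted-++ row (p *ᴸ r) k ⟩
      shifted f row k + shifted f (p *ᴸ r) k   ≈⟨ +-congʳ row≈ ⟩
      a * shifted f r (e ℤ.+ k) + shifted f (p *ᴸ r) k ∎
      where
      row : Laurent
      row = map (λ (b , d) → a * b , e ℤ.+ d) r
      row≈ : shifted f row k ≈ a * shifted f r (e ℤ.+ k)
      row≈ = begin
        shifted f row k                   ≈⟨ +-identityʳ _ ⟨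
        shifted f row k + 0#              ≈⟨ shifted-++ row [] k ⟨
        shifted f ([ (a , e) ] *ᴸ r) k    ≈⟨ shifted-term a e r k ⟩
        a * shifted f r (e ℤ.+ k)         ∎

    module _ (b c : ℕ → Carrier) where

      private
        G : ℤ → ℕ → Carrier
        G k n = shifted f (lbp b c n) k

      shifted-lbp₀ : ∀ k → G k 0 ≈ f k
      shifted-lbp₀ k = begin
        1# * f (0ℤ ℤ.+ k) + 0#  ≈⟨ +-identityʳ _ ⟩
        1# * f (0ℤ ℤ.+ k)       ≈⟨ *-identityˡ _ ⟩
        f (0ℤ ℤ.+ k)            ≡⟨ ≡.cong f (ℤ.+-identityˡ k) ⟩
        f k                     ∎

      shifted-lbp₁ : ∀ k → G (1ℤ ℤ.+ k) 0 ≈ G k 1 + c 0 * G k 0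
      shifted-lbp₁ k = begin
        G (1ℤ ℤ.+ k) 0
          ≈⟨ //-rightDividesˡ _ _ ⟨
        G (1ℤ ℤ.+ k) 0 + - (c 0 * G k 0) + c 0 * G k 0
          ≈⟨ +-congʳ (+-cong
               (trans (shifted-lbp₀ (1ℤ ℤ.+ k)) (sym (*-identityˡ _)))
               (trans (-‿distribˡ-* _ _) (trans
                 (*-congˡ (trans (shifted-lbp₀ k)
                   (reflexive (≡.cong f (≡.sym (ℤ.+-identityˡ k))))))
                 (sym (+-identityʳ _))))) ⟩
        G k 1 + c 0 * G k 0 ∎

      -- The defining recurrence of `lbp`, solved for the product of z with the polynomial of index
      -- `suc n`. It holds at every integer exponent and so serves both signs of the moments.
      shifted-lbp₂ : ∀ k n → G (1ℤ ℤ.+ k) (suc n)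
                           ≈ G k (suc (suc n))
                             + (b (suc n) * G (1ℤ ℤ.+ k) n
                                + c (suc n) * G k (suc n))
      shifted-lbp₂ k n = begin
        -- Both `x` and `y` are subtracted and added back; the differences then collect into the
        -- expansion of `lbp`.
        a                                   ≈⟨ //-rightDividesˡ x a ⟨
        a + - x + x                         ≈⟨ +-congʳ (//-rightDividesˡ y (a + - x)) ⟨
        a + - x + - y + y + x               ≈⟨ +-assoc _ _ _ ⟩
        a + - x + - y + (y + x)             ≈⟨ +-congʳ expand ⟨
        G k (suc (suc n)) + (y + x)         ∎
        where
        p r s : Laurent
        p = lbp b c (suc n)
        r = (z -ᴸ const (c (suc n))) *ᴸ p
        s = const (b (suc n)) *ᴸ z *ᴸ lbp b c n
        a x y : Carrier
        a = G (1ℤ ℤ.+ k) (suc n)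
        x = c (suc n) * G k (suc n)
        y = b (suc n) * G (1ℤ ℤ.+ k) n
        r≈ : shifted f r k ≈ a + - x
        r≈ = begin
          shifted f r k
            ≈⟨ shifted-* 1# 1ℤ [ (- c (suc n) , 0ℤ) ] p k ⟩
          1# * a + shifted f ([ (- c (suc n) , 0ℤ) ] *ᴸ p) k
            ≈⟨ +-cong (*-identityˡ a) (shifted-term _ 0ℤ p k) ⟩
          a + - c (suc n) * shifted f p (0ℤ ℤ.+ k)
            ≈⟨ +-congˡ (trans (sym (-‿distribˡ-* _ _)) (-‿cong (*-congˡ
                 (reflexive (≡.cong (shifted f p) (ℤ.+-identityˡ k)))))) ⟩
          a + - x ∎
        s≈ : shifted f s k ≈ y
        s≈ = trans (shifted-term (b (suc n) * 1#) 1ℤ (lbp b c n) k)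
                   (*-congʳ (*-identityʳ _))
        expand : G k (suc (suc n)) ≈ a + - x + - y
        expand = begin
          shifted f (r -ᴸ s) k
            ≈⟨ shifted-++ r (-ᴸ s) k ⟩
          shifted f r k + shifted f (-ᴸ s) k
            ≈⟨ +-cong r≈ (trans (shifted-neg s k) (-‿cong s≈)) ⟩
          a + - x + - y ∎

  module _ (F : Laurent → Carrier) (linear : IsLinearFunctional F) where

    open IsLinearFunctional linear

    linear-term : ∀ a e → F [ (a , e) ] ≈ a * F (z^ e)
    -- Scaling the monomial yields the coefficient `a * 1#`, so the two lists agree only up to
    -- `_≈ᴸ_`.
    linear-term a e = trans (⟦⟧-cong eq) (*ₗ-homo a (z^ e))
      where
      eq : [ (a , e) ] ≈ᴸ [ (a * 1# , e) ]
      eq k with does (e ℤ.≟ k)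
      ... | true  = +-congʳ (sym (*-identityʳ a))
      ... | false = refl

    -- A linear functional is determined by its moments. This carries biorthogonality, stated for
    -- products with `z^ k`, over to `shifted`.
    linear-shifted : ∀ p k → F (p *ᴸ z^ k) ≈ shifted (F ∘ z^_) p k
    linear-shifted []            k = 0ᴹ-homo
    linear-shifted ((a , e) ∷ p) k = begin
      F ((a * 1# , e ℤ.+ k) ∷ p *ᴸ z^ k)
        ≈⟨ +ᴹ-homo [ (a * 1# , e ℤ.+ k) ] (p *ᴸ z^ k) ⟩
      F [ (a * 1# , e ℤ.+ k) ] + F (p *ᴸ z^ k)
        ≈⟨ +-cong (trans (linear-term _ _) (*-congʳ (*-identityʳ a)))
                  (linear-shifted p k) ⟩
      a * F (z^ (e ℤ.+ k)) + shifted (F ∘ z^_) p k ∎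

  -- Defined by cases so that `1- suc n` computes to `ℤ.- (+ n)`, the form of the exponent in
  -- `biorthogonal`.
  1-_ : ℕ → ℤ
  1- zero  = 1ℤ
  1- suc n = ℤ.- (+ n)

  1+[1-suc] : ∀ n → 1ℤ ℤ.+ (1- suc n) ≡ 1- n
  1+[1-suc] zero          = ≡.refl
  1+[1-suc] (suc zero)    = ≡.refl
  1+[1-suc] (suc (suc n)) = ≡.refl

  -- Moments of positive index

  module Moments
    {t q : Carrier} (t#0 : t # 0#) (q#0 : q # 0#) (F : Laurent → Carrier)
    (functional : IsFunctionalFor
       (lbp (λ n → q ^ (2 ℕ.* n ∸ 1)) (λ n → t * q ^ (2 ℕ.* n))) F) where

    open IsFunctionalFor functional

    private
      b c′ : ℕ → Carrier
      b n = q ^ (2 ℕ.* n ∸ 1)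
      c′ n = t * q ^ (2 ℕ.* n)

      f : ℤ → Carrier
      f k = F (z^ k)

      G : ℤ → ℕ → Carrier
      G k n = shifted f (lbp b c′ n) k

    vanishing : ∀ n k → k ℕ.< n → G (ℤ.- (+ k)) n ≈ 0#
    vanishing n k k<n = begin
      G (ℤ.- (+ k)) n
        ≈⟨ linear-shifted F isLinearFunctional (lbp b c′ n) (ℤ.- (+ k)) ⟨
      F (lbp b c′ n *ᴸ z^ (ℤ.- (+ k)))
        ≈⟨ biorthogonal n k (ℕ.<⇒≤ k<n) ⟩
      h n * δ n k
        ≈⟨ *-congˡ δ≈0 ⟩
      h n * 0#
        ≈⟨ zeroʳ _ ⟩
      0# ∎
      where
      δ≈0 : δ n k ≈ 0#
      δ≈0 rewrite dec-false (n ℕ.≟ k) (ℕ.>⇒≢ k<n) = refl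

    positive : Recurrence t q (λ m n → G (+ m) n)
    positive = record
      { vanish = λ y → vanishing (suc y) 0 (s≤s z≤n)
      ; ground = λ m → shifted-lbp₁ f b c′ (+ m)
      ; raised = λ m y → shifted-lbp₂ f b c′ (+ m) y
      }

    positive-moment : ∀ k → f (+ suc k) ≈ f 1ℤ * qNarayana k t q
    positive-moment k = begin
      f (+ suc k)                    ≈⟨ shifted-lbp₀ f b c′ (+ suc k) ⟨
      G (+ suc k) 0                  ≈⟨ recurrence-qNarayana positive k ⟩
      G 1ℤ 0 * qNarayana k t q       ≈⟨ *-congʳ (shifted-lbp₀ f b c′ 1ℤ) ⟩
      f 1ℤ * qNarayana k t q         ∎

    -- Moments of index at most 0, through the reciprocal polynomials

    private
      u v : Carrier
      u = inverse t#0
      v = inverse q#0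

      x : ℕ → Carrier
      x n = t * v ^ (2 ℕ.* n)

      -- The constant term of Pₙ is the product of the `- c′ i` for i < n, and `x i * c′ i` is t².
      -- So `E n` is t^(2n) divided by that constant term, the factor which makes the reciprocal
      -- polynomial monic up to a power of t.
      E : ℕ → Carrier
      E zero    = 1#
      E (suc n) = - x n * E n

      -- The powers of t rescale z by t², which turns the reciprocal coefficient 1/cₙ into `x n`.
      H : ℕ → ℕ → Carrier
      H m n = t ^ (m ℕ.* 2) * (E n * G (1- (n ℕ.+ m)) n)

      v^n*q^n≈1 : ∀ n → v ^ n * q ^ n ≈ 1#
      v^n*q^n≈1 = x*y≈1⇒x^n*y^n≈1 (inverseˡ q#0)

      x*c≈t² : ∀ n → x n * c′ n ≈ t * t
      x*c≈t² n = begin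
        t * v ^ (2 ℕ.* n) * (t * q ^ (2 ℕ.* n))
          ≈⟨ solve 3 (λ t a b → t :* a :* (t :* b) := t :* t :* (a :* b))
               refl _ _ _ ⟩
        t * t * (v ^ (2 ℕ.* n) * q ^ (2 ℕ.* n))
          ≈⟨ *-congˡ (v^n*q^n≈1 (2 ℕ.* n)) ⟩
        t * t * 1#
          ≈⟨ *-identityʳ _ ⟩
        t * t ∎

      -- The reciprocal polynomials have bₙ/(cₙ cₙ₋₁) in place of bₙ, and rescaling by t² makes this
      -- q^(-(2n-1)). In exponents of q: (2n-1) - 2n - 2(n-1) = -(2n-1).
      x*x*b≈w*t² : ∀ y → - x (suc y) * - x y * b (suc y)
                       ≈ v ^ (2 ℕ.* suc y ∸ 1) * (t * t)
      x*x*b≈w*t² y = begin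
        - x (suc y) * - x y * b (suc y)
          ≈⟨ *-congʳ (-x*-y≈x*y (x (suc y)) (x y)) ⟩
        t * (v * w) * (t * v ^ (2 ℕ.* y)) * b (suc y)
          ≈⟨ solve 5 (λ t v w a b → t :* (v :* w) :* (t :* a) :* b
                                  := w :* (t :* t) :* (v :* a :* b))
               refl _ _ _ _ _ ⟩
        w * (t * t) * (v ^ suc (2 ℕ.* y) * b (suc y))
          -- The exponent `2 * suc y ∸ 1` computes to `y + suc (y + 0)`, which has to be matched
          -- with `suc (2 * y)`.
          ≈⟨ *-congˡ (*-congʳ (reflexive
               (≡.cong (v ^_) (≡.sym (ℕ.+-suc y (y ℕ.+ 0)))))) ⟩
        w * (t * t) * (w * b (suc y))
          ≈⟨ *-congˡ (v^n*q^n≈1 (2 ℕ.* suc y ∸ 1)) ⟩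
        w * (t * t) * 1#
          ≈⟨ *-identityʳ _ ⟩
        w * (t * t) ∎
        where
        w : Carrier
        w = v ^ (2 ℕ.* suc y ∸ 1)

      -- A z-recurrence a ≈ r + cₙ g, solved for g by means of xₙ cₙ ≈ t².
      solve-for-level : ∀ n {a r g} s → a ≈ r + c′ n * g →
                        t * (t * s) * (E n * g)
                          ≈ s * (E (suc n) * r) + x n * (s * (E n * a))
      solve-for-level n {a} {r} {g} s a≈ = sym (begin
        s * (- x n * E n * r) + x n * (s * (E n * a))
          ≈⟨ +-congˡ (*-congˡ (*-congˡ (*-congˡ a≈))) ⟩
        s * (- x n * E n * r) + x n * (s * (E n * (r + c′ n * g)))
          ≈⟨ solve 7 (λ s y e r x c g →
               s :* (y :* e :* r) :+ x :* (s :* (e :* (r :+ c :* g)))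
               := (y :+ x) :* (s :* e :* r) :+ (x :* c) :* (s :* (e :* g)))
               refl _ _ _ _ _ _ _ ⟩
        (- x n + x n) * (s * E n * r) + (x n * c′ n) * (s * (E n * g))
          ≈⟨ +-cong (trans (*-congʳ (-‿inverseˡ (x n))) (zeroˡ _))
                    (*-congʳ (x*c≈t² n)) ⟩
        0# + (t * t) * (s * (E n * g))
          ≈⟨ +-identityˡ _ ⟩
        (t * t) * (s * (E n * g))
          ≈⟨ solve 4 (λ t s e g → t :* t :* (s :* (e :* g))
                                := t :* (t :* s) :* (e :* g))
               refl _ _ _ _ ⟩
        t * (t * s) * (E n * g) ∎)

    -- The terms of the z-recurrence exchange roles: the one with cₙ becomes the left side, and the
    -- one with z Pₙ becomes the level step. The up and down steps keep their places.
    negative : Recurrence t v H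
    negative = record
      -- For `m` = 0 the exponent at index `suc y` is -y, still in the range where biorthogonality
      -- gives 0.
      { vanish = λ y → trans (*-identityˡ _) (trans
          (*-congˡ (trans
            (reflexive (≡.cong (λ j → G (1- suc j) (suc y)) (ℕ.+-identityʳ y)))
            (vanishing (suc y) y (ℕ.n<1+n y))))
          (zeroʳ _))
      ; ground = λ m → solve-for-level 0 (t ^ (m ℕ.* 2)) (begin
          G (1- m) 0
            ≡⟨ ≡.cong (λ k → G k 0) (1+[1-suc] m) ⟨
          G (1ℤ ℤ.+ (1- suc m)) 0
            ≈⟨ shifted-lbp₁ f b c′ (1- suc m) ⟩
          G (1- suc m) 1 + c′ 0 * G (1- suc m) 0 ∎)
      ; raised = raised
      }
      where
      raised : ∀ m y → H (suc m) (suc y)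
                     ≈ H m (suc (suc y))
                       + (v ^ (2 ℕ.* suc y ∸ 1) * H (suc m) y
                          + t * v ^ (2 ℕ.* suc y) * H m (suc y))
      raised m y = begin
        H (suc m) (suc y)
          ≡⟨ ≡.cong (λ k → t * (t * s) * (E (suc y) * G (1- suc k) (suc y)))
               (ℕ.+-suc y m) ⟩
        t * (t * s) * (E (suc y) * G k (suc y))
          ≈⟨ solve-for-level (suc y) s z-recurrence ⟩
        s * (E (suc (suc y)) * (G k (suc (suc y)) + b (suc y) * d)) + level-part
          -- Unfolding `E` twice brings the term with b down to `E y`, leaving the two factors `- x`
          -- that combine with b into the weight of a down step.
          ≈⟨ +-congʳ (solve 7 (λ s x₁ x₀ e g b d →
               s :* (x₁ :* (x₀ :* e) :* (g :+ b :* d))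
               := s :* (x₁ :* (x₀ :* e) :* g) :+ x₁ :* x₀ :* b :* (s :* (e :* d)))
               refl _ _ _ _ _ _ _) ⟩
        H m (suc (suc y)) + - x (suc y) * - x y * b (suc y) * (s * (E y * d))
          + level-part
          ≈⟨ +-congʳ (+-congˡ (*-congʳ (x*x*b≈w*t² y))) ⟩
        H m (suc (suc y)) + w * (t * t) * (s * (E y * d)) + level-part
          ≈⟨ +-congʳ (+-congˡ (solve 5 (λ w t s e d →
               w :* (t :* t) :* (s :* (e :* d))
               := w :* (t :* (t :* s) :* (e :* d)))
               refl _ _ _ _ _)) ⟩
        H m (suc (suc y)) + w * (t * (t * s) * (E y * d)) + level-part
          ≡⟨ ≡.cong (λ j → H m (suc (suc y))
                           + w * (t * (t * s) * (E y * G (1- j) y)) + level-part)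
               (ℕ.+-suc y m) ⟨
        H m (suc (suc y)) + w * H (suc m) y + level-part
          ≈⟨ +-assoc _ _ _ ⟩
        H m (suc (suc y)) + (w * H (suc m) y + level-part) ∎
        where
        k : ℤ
        k = 1- suc (suc (y ℕ.+ m))
        s w d level-part : Carrier
        s = t ^ (m ℕ.* 2)
        w = v ^ (2 ℕ.* suc y ∸ 1)
        d = G (1- suc (y ℕ.+ m)) y
        level-part = x (suc y) * H m (suc y)
        z-recurrence : G (1- suc (y ℕ.+ m)) (suc y)
                     ≈ G k (suc (suc y)) + b (suc y) * d + c′ (suc y) * G k (suc y)
        z-recurrence = begin
          G (1- suc (y ℕ.+ m)) (suc y)
            ≡⟨ ≡.cong (λ j → G j (suc y)) shift ⟨
          G (1ℤ ℤ.+ k) (suc y)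
            ≈⟨ shifted-lbp₂ f b c′ k y ⟩
          G k (suc (suc y)) + (b (suc y) * G (1ℤ ℤ.+ k) y + c′ (suc y) * G k (suc y))
            ≈⟨ +-assoc _ _ _ ⟨
          G k (suc (suc y)) + b (suc y) * G (1ℤ ℤ.+ k) y + c′ (suc y) * G k (suc y)
            ≡⟨ ≡.cong (λ j → G k (suc (suc y)) + b (suc y) * G j y
                             + c′ (suc y) * G k (suc y)) shift ⟩
          G k (suc (suc y)) + b (suc y) * d + c′ (suc y) * G k (suc y) ∎
          where
          shift : 1ℤ ℤ.+ k ≡ 1- suc (y ℕ.+ m)
          shift = 1+[1-suc] (suc (y ℕ.+ m))

    private
      H-ground : ∀ m → H (suc m) 0 ≈ t ^ (suc m ℕ.* 2) * f (ℤ.- (+ m))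
      H-ground m = *-congˡ
        (trans (*-identityˡ _) (shifted-lbp₀ f b c′ (ℤ.- (+ m))))

      -- This links the two halves: in `ground` at 0 the up term vanishes, and `H 0 0` is the moment
      -- at exponent 1.
      H-initial : H 1 0 ≈ t * f 1ℤ
      H-initial = begin
        H 1 0
          ≈⟨ Recurrence.ground negative 0 ⟩
        H 0 1 + t * 1# * (1# * (1# * G 1ℤ 0))
          ≈⟨ +-cong (Recurrence.vanish negative 0)
               (*-cong (*-identityʳ t) (trans (*-identityˡ _)
                 (trans (*-identityˡ _) (shifted-lbp₀ f b c′ 1ℤ)))) ⟩
        0# + t * f 1ℤ
          ≈⟨ +-identityˡ _ ⟩
        t * f 1ℤ ∎

    nonpositive-moment : ∀ k → f (ℤ.- (+ k))
                             ≈ f 1ℤ * u ^ (2 ℕ.* k ℕ.+ 1) * qNarayana k t v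
    nonpositive-moment k = begin
      f (ℤ.- (+ k))
        ≈⟨ *-identityˡ _ ⟨
      1# * f (ℤ.- (+ k))
        -- The power t^(2k+2) is the one carried by `H (suc k) 0`.
        ≈⟨ *-congʳ (x*y≈1⇒x^n*y^n≈1 (inverseˡ t#0) (suc k ℕ.* 2)) ⟨
      u ^ (suc k ℕ.* 2) * t ^ (suc k ℕ.* 2) * f (ℤ.- (+ k))
        ≈⟨ *-assoc _ _ _ ⟩
      u ^ (suc k ℕ.* 2) * (t ^ (suc k ℕ.* 2) * f (ℤ.- (+ k)))
        ≈⟨ *-congˡ (H-ground k) ⟨
      u ^ (suc k ℕ.* 2) * H (suc k) 0
        ≈⟨ *-congˡ (trans (recurrence-qNarayana negative k)
                          (*-congʳ H-initial)) ⟩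
      u * u ^ suc (k ℕ.* 2) * (t * f 1ℤ * qNarayana k t v)
        -- One factor `u` is split off to cancel the `t` from `H-initial`, which leaves the exponent
        -- 2k+1.
        ≈⟨ solve 5 (λ u a t κ n → u :* a :* (t :* κ :* n)
                                := u :* t :* (κ :* a :* n))
             refl _ _ _ _ _ ⟩
      u * t * (f 1ℤ * u ^ suc (k ℕ.* 2) * qNarayana k t v)
        ≈⟨ trans (*-congʳ (inverseˡ t#0)) (*-identityˡ _) ⟩
      f 1ℤ * u ^ suc (k ℕ.* 2) * qNarayana k t v
        ≈⟨ *-congʳ (*-congˡ (reflexive (≡.cong (u ^_) (exponent k)))) ⟩
      f 1ℤ * u ^ (2 ℕ.* k ℕ.+ 1) * qNarayana k t v ∎
      where
      exponent : ∀ k → suc (k ℕ.* 2) ≡ 2 ℕ.* k ℕ.+ 1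
      exponent = solve-∀

-- Both halves in terms of integer exponents and the normalization κ

theorem7 : ∀ {c ℓ₁ ℓ₂} (K : HeytingField c ℓ₁ ℓ₂) →
    let open HeytingField K
        open LaurentBiorthogonal K
    in
    (t q κ : Carrier) (t#0 : t # 0#) (q#0 : q # 0#) (κ#0 : κ # 0#) →
    (F : Laurent → Carrier) →
    IsFunctionalFor (lbp (λ n → q ^ (2 ℕ.* n ∸ 1)) (λ n → t * q ^ (2 ℕ.* n))) F →
    F z ≈ κ →
    (∀ (k : ℤ) → 1ℤ ℤ.≤ k →
       F (z^ k) ≈ κ * qNarayana ∣ k ℤ.- 1ℤ ∣ t q)
    ×
    (∀ (k : ℤ) → k ℤ.≤ 0ℤ →
       F (z^ k) ≈ κ * inverse t#0 ^ (2 ℕ.* ∣ k ∣ ℕ.+ 1) * qNarayana ∣ k ∣ t (inverse q#0))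
theorem7 K t q κ t#0 q#0 κ#0 F functional Fz≈κ = positive-part , nonpositive-part
  where
  open HeytingField K
  open LaurentBiorthogonal K
  open Moments K t#0 q#0 F functional

  positive-part : ∀ k → 1ℤ ℤ.≤ k → F (z^ k) ≈ κ * qNarayana ∣ k ℤ.- 1ℤ ∣ t q
  positive-part (+ suc k) (ℤ.+≤+ (s≤s z≤n)) =
    trans (positive-moment k) (*-congʳ Fz≈κ)

  nonpositive-part : ∀ k → k ℤ.≤ 0ℤ →
                     F (z^ k) ≈ κ * inverse t#0 ^ (2 ℕ.* ∣ k ∣ ℕ.+ 1)
                                  * qNarayana ∣ k ∣ t (inverse q#0)
  nonpositive-part (+ zero)   (ℤ.+≤+ z≤n) =
    trans (nonpositive-moment 0) (*-congʳ (*-congʳ Fz≈κ))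
  nonpositive-part (-[1+ k ]) ℤ.-≤+       =
    trans (nonpositive-moment (suc k)) (*-congʳ (*-congʳ Fz≈κ))
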